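{- For any two nonempty words $u$ and $v$ over $A$, $$u\prec' v=\sum_{v_1v_2=v}(-1)^{|v_1|}\,(\overline{v_1}\,u)\,ш\,v_2 ,$$ where the sum is over all factorizations of $v$ as a concatenation of two (possibly empty) words $v_1,v_2$, $\overline{v_1}$ denotes the mirror image of $v_1$, $|v_1|$ its length, and $ш$ is the shuffle product.
   Context: Let $A$ be an alphabet and $\mathbb K\langle A\rangle$ the free associative algebra on $A$, with basis the words over $A$. The shuffle product $ш$ on $\mathbb K\langle A\rangle$ is the bilinear product with the empty word as neutral element and satisfying, for letters $a,b\in A$ and words $u,v\in A^*$, $$au\,ш\,bv=a(u\,ш\,bv)+b(au\,ш\,v).$$ The half-shuffle $\prec'$ is defined on nonempty words by $$au\prec' bv=a(u\,ш\,bv).$$ The mirror image of a word $w=w_1\cdots w_n$ is $\bar w=w_n\cdots w_1$. -}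

module Defs where

open import Data.Empty using (⊥)
open import Level using (_⊔_)
open import Algebra.Bundles using (CommutativeRing)
open import Data.List.Base using (List; []; _∷_; _++_; [_]; map; foldr)
open import Data.List.NonEmpty.Base using (List⁺; _∷_; toList)
open import Data.List.Membership.Propositional using (_∈_)
open import Data.List.Membership.Propositional.Properties using (∈-map⁺; ∈-map⁻)
open import Data.List.Relation.Unary.All using (All; []; _∷_)
import Data.List.Relation.Unary.All as All
open import Data.List.Relation.Unary.Any using (here; there)
open import Data.List.Relation.Unary.Unique.Propositional using (Unique; []; _∷_)
import Data.List.Relation.Unary.Unique.Propositional.Properties as Unique
open import Data.List.Properties using (∷-injectiveʳ; ++-assoc; map-++)
open import Data.Nat.Base using (ℕ)
open import Data.Product.Base using (_×_; _,_; proj₁; proj₂; map₁)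
open import Relation.Binary.Bundles using (Setoid)
open import Relation.Binary.PropositionalEquality.Core as ≡ using (_≡_)
import Relation.Binary.Reasoning.Setoid as ≈-Reasoning

factorizations : ∀ {a} {A : Set a} → List A → List (List A × List A)
factorizations []      = [ ([] , []) ]
factorizations (a ∷ v) = ([] , a ∷ v) ∷ map (map₁ (a ∷_)) (factorizations v)

-- `factorizations v` lists every pair (v₁ , v₂) with v₁ ++ v₂ ≡ v exactly once.

module _ {a} {A : Set a} where

  ∈-factorizations⁻ : ∀ v {v₁ v₂ : List A} →
                      (v₁ , v₂) ∈ factorizations v → v₁ ++ v₂ ≡ v
  ∈-factorizations⁻ []      (here ≡.refl) = ≡.refl
  ∈-factorizations⁻ (a ∷ v) (here ≡.refl) = ≡.refl
  ∈-factorizations⁻ (a ∷ v) (there p) with ∈-map⁻ (map₁ (a ∷_)) p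
  ... | _ , q , ≡.refl = ≡.cong (a ∷_) (∈-factorizations⁻ v q)

  ∈-factorizations⁺ : ∀ (v₁ v₂ : List A) →
                      (v₁ , v₂) ∈ factorizations (v₁ ++ v₂)
  ∈-factorizations⁺ []       []       = here ≡.refl
  ∈-factorizations⁺ []       (_ ∷ _)  = here ≡.refl
  ∈-factorizations⁺ (a ∷ v₁) v₂       =
    there (∈-map⁺ (map₁ (a ∷_)) (∈-factorizations⁺ v₁ v₂))

  factorizations-unique : ∀ (v : List A) → Unique (factorizations v)
  factorizations-unique []      = [] ∷ []
  factorizations-unique (a ∷ v) =
    All.tabulate (λ p eq → []∉ p (≡.sym (≡.cong proj₁ eq))) ∷
    Unique.map⁺ inj (factorizations-unique v)
    where
    inj : ∀ {x y : List A × List A} → map₁ (a ∷_) x ≡ map₁ (a ∷_) y → x ≡ y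
    inj {x₁ , x₂} {y₁ , y₂} eq =
      ≡.cong₂ _,_ (∷-injectiveʳ (≡.cong proj₁ eq)) (≡.cong proj₂ eq)
    []∉ : ∀ {y} → y ∈ map (map₁ (a ∷_)) (factorizations v) → proj₁ y ≡ [] → ⊥
    []∉ p eq with ∈-map⁻ (map₁ (a ∷_)) p
    []∉ p () | _ , _ , ≡.refl

module FreeAlgebra {c ℓ a} (K : CommutativeRing c ℓ) (A : Set a) where

  private module K = CommutativeRing K
  open K using (Carrier; 0#; 1#)
    renaming (_≈_ to _≈ₖ_; _+_ to _+ₖ_; _*_ to _*ₖ_)

  Word : Set a
  Word = List A

  -- The free K-module on Word.  The list (k₁ , w₁) ∷ … ∷ (kₙ , wₙ) ∷ [] stands
  -- for the linear combination k₁ w₁ + … + kₙ wₙ; words may be repeated and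
  -- coefficients may vanish, so equality is _≈_ below, not _≡_.

  K⟨A⟩ : Set (c ⊔ a)
  K⟨A⟩ = List (Carrier × Word)

  infix  4 _≈_
  infixl 6 _⊕_
  infixr 7 _•_
  infix  9 [-1]^_
  infixl 8 _·_ _ш_ _шʷ_

  𝟘 : K⟨A⟩
  𝟘 = []

  _⊕_ : K⟨A⟩ → K⟨A⟩ → K⟨A⟩
  _⊕_ = _++_

  _•_ : Carrier → K⟨A⟩ → K⟨A⟩
  k • p = map (map₁ (k *ₖ_)) p

  word : Word → K⟨A⟩
  word w = [ (1# , w) ]

  ∑ : ∀ {i} {I : Set i} → List I → (I → K⟨A⟩) → K⟨A⟩
  ∑ is f = foldr (λ i p → f i ⊕ p) 𝟘 is

  -- Two lists are equal in the free module when one can be turned into the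
  -- other by reordering terms, collecting or splitting terms with the same
  -- word, inserting or deleting zero terms, and replacing coefficients by equal
  -- ones.  For decidable A this is equality of all coefficients.

  data _≈_ : K⟨A⟩ → K⟨A⟩ → Set (c ⊔ ℓ ⊔ a) where
    ≈-refl  : ∀ {p} → p ≈ p
    ≈-sym   : ∀ {p q} → p ≈ q → q ≈ p
    ≈-trans : ∀ {p q r} → p ≈ q → q ≈ r → p ≈ r
    ⊕-cong  : ∀ {p p′ q q′} → p ≈ p′ → q ≈ q′ → p ⊕ q ≈ p′ ⊕ q′
    ⊕-comm  : ∀ p q → p ⊕ q ≈ q ⊕ p
    coeff   : ∀ {k l} w → k ≈ₖ l → [ (k , w) ] ≈ [ (l , w) ]
    collect : ∀ k l w → [ (k , w) ] ⊕ [ (l , w) ] ≈ [ (k +ₖ l , w) ]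
    vanish  : ∀ w → [ (0# , w) ] ≈ 𝟘

  K⟨A⟩-setoid : Setoid (c ⊔ a) (c ⊔ ℓ ⊔ a)
  K⟨A⟩-setoid = record
    { Carrier = K⟨A⟩
    ; _≈_ = _≈_
    ; isEquivalence = record { refl = ≈-refl ; sym = ≈-sym ; trans = ≈-trans }
    }

  linear : (Word → K⟨A⟩) → K⟨A⟩ → K⟨A⟩
  linear f p = ∑ p λ (k , w) → k • f w

  bilinear : (Word → Word → K⟨A⟩) → K⟨A⟩ → K⟨A⟩ → K⟨A⟩
  bilinear f p q = linear (λ u → linear (f u) q) p

  _·_ : K⟨A⟩ → K⟨A⟩ → K⟨A⟩
  _·_ = bilinear λ u v → word (u ++ v)

  letter : A → K⟨A⟩
  letter a = word [ a ]

  _шʷ_ : Word → Word → K⟨A⟩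
  []      шʷ v       = word v
  (a ∷ u) шʷ []      = word (a ∷ u)
  (a ∷ u) шʷ (b ∷ v) =
    letter a · (u шʷ (b ∷ v)) ⊕ letter b · ((a ∷ u) шʷ v)

  _ш_ : K⟨A⟩ → K⟨A⟩ → K⟨A⟩
  _ш_ = bilinear _шʷ_

  _≺′_ : List⁺ A → List⁺ A → K⟨A⟩
  (a ∷ u) ≺′ v = letter a · (word u ш word (toList v))

  [-1]^_ : ℕ → Carrier
  [-1]^ n = (K.- 1#) ^ n
    where open import Algebra.Properties.Semiring.Exp K.semiring using (_^_)

  -- `linear` and `bilinear`, hence the two products, respect _≈_.

  ⊕-interchange : ∀ p q r s → (p ⊕ q) ⊕ (r ⊕ s) ≈ (p ⊕ r) ⊕ (q ⊕ s)
  ⊕-interchange p q r s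
    rewrite ++-assoc p q (r ⊕ s) | ++-assoc p r (q ⊕ s)
          | ≡.sym (++-assoc q r s) | ≡.sym (++-assoc r q s) =
    ⊕-cong (≈-refl {p}) (⊕-cong (⊕-comm q r) (≈-refl {s}))

  •-congʳ : ∀ {k l} → k ≈ₖ l → ∀ p → k • p ≈ l • p
  •-congʳ k≈l []            = ≈-refl
  •-congʳ k≈l ((m , w) ∷ p) =
    ⊕-cong (coeff w (K.*-congʳ k≈l)) (•-congʳ k≈l p)

  •-distribʳ : ∀ k l p → (k +ₖ l) • p ≈ k • p ⊕ l • p
  •-distribʳ k l []            = ≈-refl
  •-distribʳ k l ((m , w) ∷ p) = begin
    [ ((k +ₖ l) *ₖ m , w) ] ⊕ (k +ₖ l) • p
      ≈⟨ ⊕-cong (coeff w (K.distribʳ m k l)) (•-distribʳ k l p) ⟩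
    [ (k *ₖ m +ₖ l *ₖ m , w) ] ⊕ (k • p ⊕ l • p)
      ≈⟨ ⊕-cong (collect (k *ₖ m) (l *ₖ m) w) ≈-refl ⟨
    ([ (k *ₖ m , w) ] ⊕ [ (l *ₖ m , w) ]) ⊕ (k • p ⊕ l • p)
      ≈⟨ ⊕-interchange [ _ ] [ _ ] (k • p) (l • p) ⟩
    ([ (k *ₖ m , w) ] ⊕ k • p) ⊕ ([ (l *ₖ m , w) ] ⊕ l • p) ∎
    where open ≈-Reasoning K⟨A⟩-setoid

  •-zeroˡ : ∀ p → 0# • p ≈ 𝟘
  •-zeroˡ []            = ≈-refl
  •-zeroˡ ((m , w) ∷ p) =
    ⊕-cong (≈-trans (coeff w (K.zeroˡ m)) (vanish w)) (•-zeroˡ p)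

  •-distribˡ : ∀ k p q → k • (p ⊕ q) ≡ k • p ⊕ k • q
  •-distribˡ k p q = map-++ (map₁ (k *ₖ_)) p q

  •-cong : ∀ k {p q} → p ≈ q → k • p ≈ k • q
  •-cong k ≈-refl        = ≈-refl
  •-cong k (≈-sym e)     = ≈-sym (•-cong k e)
  •-cong k (≈-trans e f) = ≈-trans (•-cong k e) (•-cong k f)
  •-cong k (⊕-cong {p} {p′} {q} {q′} e f)
    rewrite •-distribˡ k p q | •-distribˡ k p′ q′ =
    ⊕-cong (•-cong k e) (•-cong k f)
  •-cong k (⊕-comm p q)
    rewrite •-distribˡ k p q | •-distribˡ k q p =
    ⊕-comm (k • p) (k • q)
  •-cong k (coeff w e)     = coeff w (K.*-congˡ e)
  •-cong k (collect l m w) =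
    ≈-trans (collect _ _ w) (coeff w (K.sym (K.distribˡ k l m)))
  •-cong k (vanish w)      = ≈-trans (coeff w (K.zeroʳ k)) (vanish w)

  linear-⊕ : ∀ f p q → linear f (p ⊕ q) ≡ linear f p ⊕ linear f q
  linear-⊕ f []            q = ≡.refl
  linear-⊕ f ((k , w) ∷ p) q = ≡.trans
    (≡.cong (k • f w ⊕_) (linear-⊕ f p q))
    (≡.sym (++-assoc (k • f w) (linear f p) (linear f q)))

  ⊕-identityʳ : ∀ p → p ⊕ 𝟘 ≈ p
  ⊕-identityʳ p = ⊕-comm p 𝟘

  linear-cong : ∀ f {p q} → p ≈ q → linear f p ≈ linear f q
  linear-cong f ≈-refl        = ≈-refl
  linear-cong f (≈-sym e)     = ≈-sym (linear-cong f e)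
  linear-cong f (≈-trans e g) = ≈-trans (linear-cong f e) (linear-cong f g)
  linear-cong f (⊕-cong {p} {p′} {q} {q′} e g)
    rewrite linear-⊕ f p q | linear-⊕ f p′ q′ =
    ⊕-cong (linear-cong f e) (linear-cong f g)
  linear-cong f (⊕-comm p q)
    rewrite linear-⊕ f p q | linear-⊕ f q p = ⊕-comm (linear f p) (linear f q)
  linear-cong f (coeff w e)     = ⊕-cong (•-congʳ e (f w)) ≈-refl
  linear-cong f (collect k l w) = begin
    k • f w ⊕ (l • f w ⊕ 𝟘)   ≈⟨ ⊕-cong ≈-refl (⊕-identityʳ (l • f w)) ⟩
    k • f w ⊕ l • f w         ≈⟨ •-distribʳ k l (f w) ⟨
    (k +ₖ l) • f w            ≈⟨ ⊕-identityʳ _ ⟨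
    (k +ₖ l) • f w ⊕ 𝟘        ∎
    where open ≈-Reasoning K⟨A⟩-setoid
  linear-cong f (vanish w)      = ⊕-cong (•-zeroˡ (f w)) ≈-refl

  linear-ext : ∀ {f g} → (∀ w → f w ≈ g w) → ∀ p → linear f p ≈ linear g p
  linear-ext f≈g []            = ≈-refl
  linear-ext f≈g ((k , w) ∷ p) = ⊕-cong (•-cong k (f≈g w)) (linear-ext f≈g p)

  bilinear-cong : ∀ f {p p′ q q′} → p ≈ p′ → q ≈ q′ →
                  bilinear f p q ≈ bilinear f p′ q′
  bilinear-cong f {p′ = p′} p≈p′ q≈q′ = ≈-trans
    (linear-cong _ p≈p′)
    (linear-ext (λ u → linear-cong (f u) q≈q′) p′)

  bilinear-word : ∀ f u v → bilinear f (word u) (word v) ≈ f u v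
  bilinear-word f u v = ≈-trans
    (linear-word (λ u → linear (f u) (word v)) u)
    (linear-word (f u) v)
    where
    1•-identity : ∀ p → 1# • p ≈ p
    1•-identity []            = ≈-refl
    1•-identity ((m , w) ∷ p) = ⊕-cong (coeff w (K.*-identityˡ m)) (1•-identity p)
    linear-word : ∀ g w → linear g (word w) ≈ g w
    linear-word g w = ≈-trans (⊕-identityʳ (1# • g w)) (1•-identity (g w))

-- The first factorization of v = b v′ contributes
-- a u ш b v′ = a (u ш b v′) + b (a u ш v′).  The others have v₁ = b v₁′, with
-- mirror image ending in b, so they sum to minus the right-hand side for the
-- pair (b a u , v′), which is − b (a u ш v′) by induction on v.

{-# OPTIONS --safe #-}
module Submission where

open import Defs
open import Algebra.Bundles using (CommutativeRing)
open import Data.List.Base using ([]; _∷_; length; reverse; _++_; map)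
open import Data.List.NonEmpty.Base using (List⁺; _∷_; toList)
open import Data.List.Properties using (++-assoc; foldr-map; unfold-reverse)
open import Data.Product.Base using (_×_; _,_; map₁)
open import Relation.Binary.PropositionalEquality.Core as ≡ using (_≡_)
import Relation.Binary.Reasoning.Setoid as ≈-Reasoning

module _ {c ℓ a} (K : CommutativeRing c ℓ) (A : Set a) where

  open FreeAlgebra K A
  private module K = CommutativeRing K

  •-identity : ∀ p → K.1# • p ≈ p
  •-identity []            = ≈-refl
  •-identity ((k , w) ∷ p) = ⊕-cong (coeff w (K.*-identityˡ k)) (•-identity p)

  •-assoc : ∀ k l p → (k K.* l) • p ≈ k • (l • p)
  •-assoc k l []            = ≈-refl
  •-assoc k l ((m , w) ∷ p) = ⊕-cong (coeff w (K.*-assoc k l m)) (•-assoc k l p)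

  -- Negatives in `K⟨A⟩` are scalings by `K.- K.1#`, the same scalar that each further letter of
  -- `v₁` contributes to the sign, so cancellation reduces to `1 + (-1) = 0` in `K`.
  ⊕-inverseʳ : ∀ p → p ⊕ (K.- K.1#) • p ≈ 𝟘
  ⊕-inverseʳ p = begin
    p ⊕ (K.- K.1#) • p             ≈⟨ ⊕-cong (•-identity p) ≈-refl ⟨
    K.1# • p ⊕ (K.- K.1#) • p      ≈⟨ •-distribʳ K.1# (K.- K.1#) p ⟨
    (K.1# K.+ K.- K.1#) • p        ≈⟨ •-congʳ (K.-‿inverseʳ K.1#) p ⟩
    K.0# • p                       ≈⟨ •-zeroˡ p ⟩
    𝟘                              ∎
    where open ≈-Reasoning K⟨A⟩-setoid

  module _ {i} {I : Set i} where

    ∑-cong : ∀ {f g : I → K⟨A⟩} → (∀ i → f i ≈ g i) → ∀ is → ∑ is f ≈ ∑ is g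
    ∑-cong f≈g []       = ≈-refl
    ∑-cong f≈g (i ∷ is) = ⊕-cong (f≈g i) (∑-cong f≈g is)

    ∑-• : ∀ k (f : I → K⟨A⟩) is → ∑ is (λ i → k • f i) ≡ k • ∑ is f
    ∑-• k f []       = ≡.refl
    ∑-• k f (i ∷ is) = ≡.trans
      (≡.cong (k • f i ⊕_) (∑-• k f is))
      (≡.sym (•-distribˡ k (f i) (∑ is f)))

  ·-congˡ : ∀ p {q q′} → q ≈ q′ → p · q ≈ p · q′
  ·-congˡ p = bilinear-cong (λ u v → word (u ++ v)) (≈-refl {p})

  word-ш-word : ∀ u v → word u ш word v ≈ u шʷ v
  word-ш-word = bilinear-word _шʷ_

  шʷ-identityʳ : ∀ u → u шʷ [] ≡ word u
  шʷ-identityʳ []      = ≡.refl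
  шʷ-identityʳ (_ ∷ _) = ≡.refl

  signedTerm : Word → Word × Word → K⟨A⟩
  signedTerm u (v₁ , v₂) = [-1]^ length v₁ • (word (reverse v₁ ++ u) ш word v₂)

  -- Mirroring puts `b` last, next to `u`, where it can be absorbed as the new head of `u`. The
  -- extra letter in the length accounts for the sign.
  signedTerm-∷ : ∀ b u v₁₂ →
    signedTerm u (map₁ (b ∷_) v₁₂) ≈ (K.- K.1#) • signedTerm (b ∷ u) v₁₂
  signedTerm-∷ b u (v₁ , v₂)
    rewrite unfold-reverse b v₁ | ++-assoc (reverse v₁) (b ∷ []) u =
    •-assoc (K.- K.1#) ([-1]^ length v₁) _

  -- Induction on `v` with `a` and `u` left free, since the recursive call lengthens the first word.
  -- The second word may be empty, which extends the half-shuffle by letting the empty word act as a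
  -- right unit and gives the induction its base.
  letter-·-ш : ∀ a u v →
    letter a · (word u ш word v) ≈ ∑ (factorizations v) (signedTerm (a ∷ u))
  letter-·-ш a u [] = begin
    letter a · (word u ш word [])             ≈⟨ ·-congˡ (letter a) (word-ш-word u []) ⟩
    letter a · (u шʷ [])                      ≡⟨ ≡.cong (letter a ·_) (шʷ-identityʳ u) ⟩
    letter a · word u                         ≈⟨ bilinear-word (λ u v → word (u ++ v)) (a ∷ []) u ⟩
    (a ∷ u) шʷ []                             ≈⟨ word-ш-word (a ∷ u) [] ⟨
    word (a ∷ u) ш word []                    ≈⟨ •-identity _ ⟨
    signedTerm (a ∷ u) ([] , [])              ≈⟨ ⊕-identityʳ _ ⟨
    signedTerm (a ∷ u) ([] , []) ⊕ 𝟘          ∎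
    where open ≈-Reasoning K⟨A⟩-setoid
  letter-·-ш a u (b ∷ v) = begin
    letter a · (word u ш word (b ∷ v))
      ≈⟨ ·-congˡ (letter a) (word-ш-word u (b ∷ v)) ⟩
    p
      ≈⟨ ⊕-identityʳ p ⟨
    p ⊕ 𝟘
      -- `q` is the summand that completes `p` to the full shuffle; its negative is left for the
      -- factorizations with nonempty `v₁`.
      ≈⟨ ⊕-cong (≈-refl {p}) (⊕-inverseʳ q) ⟨
    p ⊕ (q ⊕ (K.- K.1#) • q)
      ≡⟨ ++-assoc p q _ ⟨
    (p ⊕ q) ⊕ (K.- K.1#) • q
      ≈⟨ ⊕-cong first (≈-sym rest) ⟩
    ∑ (factorizations (b ∷ v)) (signedTerm (a ∷ u)) ∎
    where
    open ≈-Reasoning K⟨A⟩-setoid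
    p = letter a · (u шʷ (b ∷ v))
    q = letter b · ((a ∷ u) шʷ v)

    first : p ⊕ q ≈ signedTerm (a ∷ u) ([] , b ∷ v)
    first = ≈-sym (≈-trans (•-identity _) (word-ш-word (a ∷ u) (b ∷ v)))

    rest : ∑ (map (map₁ (b ∷_)) (factorizations v)) (signedTerm (a ∷ u))
         ≈ (K.- K.1#) • q
    rest = begin
      ∑ (map (map₁ (b ∷_)) (factorizations v)) (signedTerm (a ∷ u))
        ≡⟨ foldr-map _ _ 𝟘 (factorizations v) ⟩
      ∑ (factorizations v) (λ v₁₂ → signedTerm (a ∷ u) (map₁ (b ∷_) v₁₂))
        ≈⟨ ∑-cong (signedTerm-∷ b (a ∷ u)) (factorizations v) ⟩
      ∑ (factorizations v) (λ v₁₂ → (K.- K.1#) • signedTerm (b ∷ a ∷ u) v₁₂)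
        ≡⟨ ∑-• (K.- K.1#) (signedTerm (b ∷ a ∷ u)) (factorizations v) ⟩
      (K.- K.1#) • ∑ (factorizations v) (signedTerm (b ∷ a ∷ u))
        -- The induction hypothesis, read from right to left: `b` is now the leading letter and
        -- `a ∷ u` the tail.
        ≈⟨ •-cong (K.- K.1#) (letter-·-ш b (a ∷ u) v) ⟨
      (K.- K.1#) • (letter b · (word (a ∷ u) ш word v))
        ≈⟨ •-cong (K.- K.1#) (·-congˡ (letter b) (word-ш-word (a ∷ u) v)) ⟩
      (K.- K.1#) • q ∎

lemma4p1 : ∀ {c ℓ a} (K : CommutativeRing c ℓ) (A : Set a) →
    let open FreeAlgebra K A in (u v : List⁺ A) →
    u ≺′ v ≈ ∑ (factorizations (toList v)) (λ (v₁ , v₂) →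
    [-1]^ length v₁ • (word (reverse v₁ ++ toList u) ш word v₂))
-- Both sides agree with those of `letter-·-ш` by unfolding `_≺′_`, `toList` and `signedTerm`.
lemma4p1 K A (a ∷ u) v = letter-·-ш K A a u (toList v)
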